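{- Let $C_{3}$ be the simplicial complex obtained from $3$ disjoint copies of $Q^*$ by identifying them along the subcomplex $A^*$. Then $C_3$ is balanced, Cohen-Macaulay (over any field), and not partitionable. (Its $f$-vector is $(1,22,101,140,60)$.)
   Context: $Q^*$ is the $3$-dimensional simplicial complex on vertex set $\{0,1,\dots,13\}$ whose faces are all subsets of the following $20$ facets: $\{2,5,6,12\}$, $\{1,5,8,11\}$, $\{0,1,2,5\}$, $\{1,4,8,9\}$, $\{1,2,3,10\}$, $\{4,5,8,13\}$, $\{0,1,2,3\}$, $\{1,4,9,10\}$, $\{1,2,9,10\}$, $\{1,2,5,6\}$, $\{0,2,5,12\}$, $\{4,5,7,13\}$, $\{1,4,5,8\}$, $\{1,2,6,9\}$, $\{1,3,4,7\}$, $\{1,3,4,10\}$, $\{1,5,6,11\}$, $\{1,4,5,7\}$, $\{1,6,9,11\}$, $\{1,8,9,11\}$. $A^*$ is the induced subcomplex of $Q^*$ on vertex set $\{0,2,3,4,6,7,8,10,12,13\}$; its facets are $\{0,2,3\}$, $\{4,7,13\}$, $\{3,4,10\}$, $\{0,2,12\}$, $\{3,4,7\}$, $\{2,3,10\}$, $\{2,6,12\}$, $\{4,8,13\}$. Identifying $N$ copies of $Q^*$ along $A^*$ means taking copies $Q^*_1,\dots,Q^*_N$ with pairwise disjoint vertex sets except that the vertices of $A^*$ are shared (the same in all copies). A $(d-1)$-dimensional complex is balanced if its graph is properly $d$-colorable. A pure simplicial complex with facets $F_1,\dots,F_n$ is partitionable if its faces are the disjoint union of Boolean intervals $[R_i,F_i]=\{G: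 R_i\subseteq G\subseteq F_i\}$. A $(d-1)$-dimensional complex $\Delta$ is Cohen-Macaulay over a field $\mathbb{F}$ if for every face $F$ (including $\emptyset$), $\widetilde{H}_i(\mathrm{lk}_\Delta(F);\mathbb{F})=0$ for all $i\neq d-1-\#F$, where $\mathrm{lk}_\Delta(F)=\{G\in\Delta: G\cap F=\emptyset, G\cup F\in\Delta\}$. The $f$-vector lists the numbers of faces of dimensions $-1,0,1,2,3$. -}

module Defs where

open import Level using (0ℓ; _⊔_) renaming (suc to lsuc)
open import Algebra.Bundles using (CommutativeRing)
open import Data.Bool.Base using (if_then_else_)
open import Data.Nat.Base as ℕ using (ℕ; suc)
open import Data.Integer.Base as ℤ using (ℤ; +_; 1ℤ; _-_; _≤_)
open import Data.Fin.Base using (Fin; zero; suc; toℕ; join; combine)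
open import Data.Fin using (#_)
open import Data.Fin.Subset
  using (Subset; inside; outside; ⁅_⁆; ⊥; _∪_; _∩_; ∁; ⋃; _⊆_; ∣_∣) renaming (_∈_ to _∈ˢ_)
open import Data.Fin.Subset.Properties
  using (⊆-trans; ⊆-antisym; ⊆-min; x∈p∪q⁻; x∈p∪q⁺; x∈p∩q⁺; x∈p∩q⁻)
open import Data.Vec.Base using (Vec; []; _∷_; lookup)
open import Data.List.Base using (List; []; _∷_; map; concatMap; allFin; length)
open import Data.List.Membership.Propositional using (_∈_)
open import Data.List.Relation.Unary.Any as Any using (Any)
open import Data.List.Relation.Unary.Unique.Propositional using (Unique)
open import Data.Product using (Σ-syntax; ∃-syntax; ∃!; _×_; _,_)
open import Data.Sum.Base using (_⊎_; inj₁; inj₂; map₁; map₂)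
open import Function.Bundles using (_⇔_)
open import Relation.Nullary.Negation.Core using (¬_)
open import Relation.Unary using (Pred)
open import Relation.Binary.PropositionalEquality using (_≡_; _≢_; subst)

------------------------------------------------------------------------
-- Simplicial complexes

-- Elements of Fin n need not all be vertices, and the void complex is
-- allowed; both occur among the links below.
record Complex (n : ℕ) : Set₁ where
  field
    Face       : Pred (Subset n) 0ℓ
    downClosed : ∀ {σ τ} → τ ⊆ σ → Face σ → Face τ

open Complex public

private variable
  n : ℕ

-- ∅ has dimension -1.
dim : Subset n → ℤ
dim σ = + ∣ σ ∣ - 1ℤ

IsFacet : Complex n → Subset n → Set
IsFacet Δ σ = Face Δ σ × (∀ τ → Face Δ τ → σ ⊆ τ → σ ≡ τ)

HasDim : Complex n → ℤ → Set
HasDim Δ δ = (∃[ σ ] Face Δ σ × dim σ ≡ δ) × (∀ σ → Face Δ σ → dim σ ≤ δ)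

⟨_⟩ : List (List (Fin n)) → Complex n
⟨ Fs ⟩ = record
  { Face       = λ σ → Any (λ F → σ ⊆ ⋃ (map ⁅_⁆ F)) Fs
  ; downClosed = λ τ⊆σ → Any.map (⊆-trans τ⊆σ)
  }

link : Complex n → Subset n → Complex n
link Δ F = record
  { Face       = λ G → Face Δ G × G ∩ F ≡ ⊥ × Face Δ (G ∪ F)
  ; downClosed = λ {G} {H} H⊆G (ΔG , G∩F≡⊥ , ΔG∪F) →
        downClosed Δ H⊆G ΔG
      , ⊆-antisym
          (λ x∈H∩F → let x∈H , x∈F = x∈p∩q⁻ H F x∈H∩F in
                     subst (_ ∈ˢ_) G∩F≡⊥ (x∈p∩q⁺ (H⊆G x∈H , x∈F)))
          (⊆-min (H ∩ F))
      , downClosed Δ (λ x∈H∪F → x∈p∪q⁺ (map₁ H⊆G (x∈p∪q⁻ H F x∈H∪F))) ΔG∪F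
  }

------------------------------------------------------------------------
-- f-vector, balancedness, partitionability

HasCardinality : Pred (Subset n) 0ℓ → ℕ → Set
HasCardinality P m =
  ∃[ σs ] Unique σs × (∀ σ → σ ∈ σs ⇔ P σ) × length σs ≡ m

-- f = (f₋₁ , f₀ , … , f_{d-1}), where d - 1 is the dimension of Δ.
HasFVector : ∀ {d} → Complex n → Vec ℕ (suc d) → Set
HasFVector {d = d} Δ f =
    HasDim Δ (+ d - 1ℤ)
  × (∀ j → HasCardinality (λ σ → Face Δ σ × dim σ ≡ + toℕ j - 1ℤ) (lookup f j))

Colorable : ℕ → Complex n → Set
Colorable {n} d Δ =
  Σ[ κ ∈ (Fin n → Fin d) ] (∀ u v → u ≢ v → Face Δ (⁅ u ⁆ ∪ ⁅ v ⁆) → κ u ≢ κ v)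

Balanced : Complex n → Set
Balanced Δ = ∃[ d ] HasDim Δ (+ d - 1ℤ) × Colorable d Δ

-- The intervals [ R F , F ], for F a facet, are subsets of Δ; they
-- partition Δ when each face lies in exactly one of them.  The values of
-- R away from facets are irrelevant.
Partitionable : Complex n → Set
Partitionable {n} Δ =
  Σ[ R ∈ (Subset n → Subset n) ]
    (∀ F → IsFacet Δ F → R F ⊆ F)
  × (∀ G → Face Δ G → ∃! _≡_ λ F → IsFacet Δ F × R F ⊆ G × G ⊆ F)

------------------------------------------------------------------------
-- Reduced simplicial homology and the Cohen-Macaulay property

record Field c ℓ : Set (lsuc (c ⊔ ℓ)) where
  field
    commutativeRing : CommutativeRing c ℓ
  open CommutativeRing commutativeRing public
  field
    0≉1     : ¬ 0# ≈ 1#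
    inverse : ∀ x → ¬ x ≈ 0# → ∃[ y ] x * y ≈ 1#

-- The number of elements of σ that are smaller than v.
before : Fin n → Subset n → ℕ
before zero    _             = 0
before (suc v) (outside ∷ σ) = before v σ
before (suc v) (inside  ∷ σ) = suc (before v σ)

module Homology {c ℓ} (K : Field c ℓ) where
  open Field K hiding (_-_)
  open import Algebra.Properties.CommutativeMonoid.Sum +-commutativeMonoid using (sum)
  open import Algebra.Properties.Semiring.Exp semiring using (_^_)

  -- A chain is given by its coefficients, σ being oriented by the order of
  -- Fin n.
  IsChain : Complex n → ℤ → (Subset n → Carrier) → Set ℓ
  IsChain Δ i a = ∀ σ → ¬ (Face Δ σ × dim σ ≡ i) → a σ ≈ 0#

  -- ∂ [v₀ < … < vₖ] = Σⱼ (-1)ʲ [v₀ … v̂ⱼ … vₖ]; hence the coefficient of τ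
  -- in ∂ a is a sum over the vertices v that can be added to τ, and v has
  -- position before v τ in τ ∪ {v}.
  ∂ : (Subset n → Carrier) → Subset n → Carrier
  ∂ a τ = sum λ v →
    if lookup τ v then 0# else (- 1#) ^ before v τ * a (⁅ v ⁆ ∪ τ)

  -- H̃ᵢ(Δ; K) = 0: every i-cycle is a boundary.  In degree 0, ∂ is the
  -- augmentation, with values in the coefficient of ∅.
  H̃Vanishes : Complex n → ℤ → Set (c ⊔ ℓ)
  H̃Vanishes Δ i =
    ∀ a → IsChain Δ i a → (∀ τ → ∂ a τ ≈ 0#) →
    ∃[ b ] IsChain Δ (i ℤ.+ 1ℤ) b × (∀ σ → ∂ b σ ≈ a σ)

  CohenMacaulay : Complex n → Set (c ⊔ ℓ)
  CohenMacaulay Δ =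
    ∃[ d ] HasDim Δ (+ d - 1ℤ)
         × (∀ F → Face Δ F → ∀ i → i ≢ + d - 1ℤ - + ∣ F ∣ → H̃Vanishes (link Δ F) i)

open Homology public using (CohenMacaulay)

------------------------------------------------------------------------
-- Gluing copies of a complex

-- An element of W or of its complement, renumbered in increasing order.
split : (W : Subset n) → Fin n → Fin ∣ W ∣ ⊎ Fin ∣ ∁ W ∣
split (inside  ∷ W) zero    = inj₁ zero
split (outside ∷ W) zero    = inj₂ zero
split (inside  ∷ W) (suc v) = map₁ suc (split W v)
split (outside ∷ W) (suc v) = map₂ suc (split W v)

-- The vertex of N glued copies corresponding to v in the i-th copy: the
-- first ∣ W ∣ vertices are shared by all copies, and then each copy has its
-- own ∣ ∁ W ∣ vertices.
copy : ∀ {N} (W : Subset n) → Fin N → Fin n → Fin (∣ W ∣ ℕ.+ N ℕ.* ∣ ∁ W ∣)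
copy {N = N} W i v = join ∣ W ∣ (N ℕ.* ∣ ∁ W ∣) (map₂ (combine i) (split W v))

-- N copies of ⟨ Fs ⟩ glued along its induced subcomplex on W.
glue : (N : ℕ) (W : Subset n) → List (List (Fin n)) →
       Complex (∣ W ∣ ℕ.+ N ℕ.* ∣ ∁ W ∣)
glue N W Fs = ⟨ concatMap (λ i → map (map (copy W i)) Fs) (allFin N) ⟩

Q*-facets : List (List (Fin 14))
Q*-facets =
    (# 2 ∷ # 5 ∷ # 6 ∷ # 12 ∷ [])
  ∷ (# 1 ∷ # 5 ∷ # 8 ∷ # 11 ∷ [])
  ∷ (# 0 ∷ # 1 ∷ # 2 ∷ # 5  ∷ [])
  ∷ (# 1 ∷ # 4 ∷ # 8 ∷ # 9  ∷ [])
  ∷ (# 1 ∷ # 2 ∷ # 3 ∷ # 10 ∷ [])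
  ∷ (# 4 ∷ # 5 ∷ # 8 ∷ # 13 ∷ [])
  ∷ (# 0 ∷ # 1 ∷ # 2 ∷ # 3  ∷ [])
  ∷ (# 1 ∷ # 4 ∷ # 9 ∷ # 10 ∷ [])
  ∷ (# 1 ∷ # 2 ∷ # 9 ∷ # 10 ∷ [])
  ∷ (# 1 ∷ # 2 ∷ # 5 ∷ # 6  ∷ [])
  ∷ (# 0 ∷ # 2 ∷ # 5 ∷ # 12 ∷ [])
  ∷ (# 4 ∷ # 5 ∷ # 7 ∷ # 13 ∷ [])
  ∷ (# 1 ∷ # 4 ∷ # 5 ∷ # 8  ∷ [])
  ∷ (# 1 ∷ # 2 ∷ # 6 ∷ # 9  ∷ [])
  ∷ (# 1 ∷ # 3 ∷ # 4 ∷ # 7  ∷ [])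
  ∷ (# 1 ∷ # 3 ∷ # 4 ∷ # 10 ∷ [])
  ∷ (# 1 ∷ # 5 ∷ # 6 ∷ # 11 ∷ [])
  ∷ (# 1 ∷ # 4 ∷ # 5 ∷ # 7  ∷ [])
  ∷ (# 1 ∷ # 6 ∷ # 9 ∷ # 11 ∷ [])
  ∷ (# 1 ∷ # 8 ∷ # 9 ∷ # 11 ∷ [])
  ∷ []

-- A* is the subcomplex of Q* induced on these vertices.
A*-vertices : Subset 14
A*-vertices = ⋃ (map ⁅_⁆
  (# 0 ∷ # 2 ∷ # 3 ∷ # 4 ∷ # 6 ∷ # 7 ∷ # 8 ∷ # 10 ∷ # 12 ∷ # 13 ∷ []))

C₃ : Complex 22
C₃ = glue 3 A*-vertices Q*-facets

{-# OPTIONS --safe #-}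
module Submission where

-- Cohen-Macaulayness: glue the simplices of a link one after another, so that
-- each meets the union of the earlier ones in an acyclic complex; by
-- Mayer-Vietoris the link stays acyclic below its top degree.
--
-- Non-partitionability: by the f-vector, all intervals [ R , F ] of a
-- partition have ∣ R ∣ ≤ 2.  Under this bound, in each copy of Q* one of the
-- five facets 4 5 7 13, 4 5 8 13, 1 4 5 7, 1 4 5 8, 1 4 8 9 has an interval
-- containing the edge 4 8 or the vertex 5, and symmetrically one of
-- 0 2 5 12, 2 5 6 12, 0 1 2 5, 1 2 5 6, 1 2 6 9 has an interval containing the
-- edge 2 6 or the vertex 5.  As 5 lies in one interval only, every copy covers
-- 4 8 or 2 6.  These edges are shared by all three copies, so one of them is
-- covered twice.

open import Defs
open import Level using (Level)
open import Data.Bool.Base using (Bool; true; false; if_then_else_; not; _∧_)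
import Data.Bool.Properties as Bool
import Data.Empty as Empty
open import Data.Nat.Base as ℕ using (ℕ; zero; suc; z≤n; s≤s)
import Data.Nat.ListAction as ℕ
import Data.Nat.ListAction.Properties as ℕ
import Data.Nat.Properties as ℕ
open import Data.Integer.Base as ℤ using (+_; -[1+_]; 1ℤ)
import Data.Integer.Properties as ℤ
open import Data.Integer.Tactic.RingSolver using (solve-∀)
open import Data.Fin.Base as Fin using (Fin; zero; suc; toℕ)
open import Data.Fin using (#_)
import Data.Fin.Properties as Fin
open import Data.Fin.Subset
  using (Subset; inside; outside; ⁅_⁆; ⊥; _∪_; _∩_; ∁; ⋃; _-_; _⊆_; ∣_∣; Nonempty)
  renaming (_∈_ to _∈ˢ_)
open import Data.Fin.Subset.Properties
open import Data.Vec.Base as Vec using (Vec; []; _∷_; lookup; here; there)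
import Data.Vec.Properties as Vec
open import Data.List.Base
  using (List; []; _∷_; _++_; map; concatMap; allFin; length; filter; deduplicate)
open import Data.List.Properties using (map-++)
open import Data.List.Membership.Propositional using (_∈_; find; lose)
open import Data.List.Membership.Propositional.Properties
open import Data.List.Membership.Propositional.Properties.WithK using (unique∧set⇒bag)
open import Data.List.Relation.Binary.BagAndSetEquality using (∼bag⇒↭)
open import Data.List.Relation.Binary.Permutation.Propositional using (_↭_; ↭-sym)
open import Data.List.Relation.Binary.Permutation.Propositional.Properties
  using (Any-resp-↭; shift; ++⁺ˡ; ++-comm; map⁺)
open import Data.List.Relation.Unary.All as All using (All; []; _∷_)
open import Data.List.Relation.Unary.AllPairs using ([]; _∷_)
open import Data.List.Relation.Unary.Any as Any using (Any; here; there)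
import Data.List.Relation.Unary.Any.Properties as Any
open import Data.List.Relation.Unary.Unique.Propositional using (Unique)
import Data.List.Relation.Unary.Unique.Propositional.Properties as Unique
open import Data.Product using (∃-syntax; _,_; proj₁; proj₂)
open import Data.Product.Base using (_×_)
open import Data.Sum.Base using (_⊎_; inj₁; inj₂; [_,_]′)
open import Function.Base using (_∘_; id; case_of_)
open import Function.Bundles using (_⇔_; mk⇔; Equivalence)
open import Relation.Nullary using (Dec; yes; no; does; contradiction)
open import Relation.Nullary.Decidable
  using (_⊎-dec_; _×-dec_; ¬?; map′; toWitness; decidable-stable)
open import Relation.Nullary.Negation.Core using (¬_)
open import Relation.Unary using (Decidable)
open import Relation.Binary.Definitions using (DecidableEquality; tri<; tri≈; tri>)
open import Relation.Binary.PropositionalEquality as ≡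
  using (_≡_; _≢_; refl; cong; cong₂; subst)

private variable
  n : ℕ

-- Complexes spanned by finite lists of faces.

Span : List (Subset n) → Subset n → Set
Span Fs σ = Any (λ F → σ ⊆ F) Fs

span? : (Fs : List (Subset n)) → Decidable (Span Fs)
span? Fs σ = Any.any? (σ ⊆?_) Fs

Generates : List (Subset n) → Complex n → Set
Generates Fs Δ = (∀ {σ} → Face Δ σ → Span Fs σ) × (∀ {σ} → Span Fs σ → Face Δ σ)

Span-⊆ : ∀ {Fs} {σ τ : Subset n} → τ ⊆ σ → Span Fs σ → Span Fs τ
Span-⊆ τ⊆σ = Any.map (⊆-trans τ⊆σ)

∣insert∣ : ∀ (v : Fin n) σ → lookup σ v ≡ outside → ∣ ⁅ v ⁆ ∪ σ ∣ ≡ suc ∣ σ ∣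
∣insert∣ zero    (outside ∷ σ) _   = cong (λ p → suc ∣ p ∣) (∪-identityˡ σ)
∣insert∣ (suc v) (outside ∷ σ) v∉σ = ∣insert∣ v σ v∉σ
∣insert∣ (suc v) (inside  ∷ σ) v∉σ = cong suc (∣insert∣ v σ v∉σ)

∣σ∣≡0⇒σ⊆F : ∀ {σ} (F : Subset n) → ∣ σ ∣ ≡ 0 → σ ⊆ F
∣σ∣≡0⇒σ⊆F {σ = σ} _ ∣σ∣≡0 {x} x∈σ =
  contradiction (subst (∣ σ - x ∣ ℕ.<_) ∣σ∣≡0 (x∈p⇒∣p-x∣<∣p∣ x∈σ)) λ ()

⊈⊥⇒Nonempty : ∀ {F : Subset n} → ¬ F ⊆ ⊥ → Nonempty F
⊈⊥⇒Nonempty {F = F} F⊈⊥ with nonempty? F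
... | yes F≢∅ = F≢∅
... | no  F≡∅ = contradiction (λ {x} → subst (x ∈ˢ_) (Empty-unique F≡∅)) F⊈⊥

-- acyclic? d Fs builds the complex generated by Fs one face at a time,
-- postponing a face that meets what is already built in a complex not known
-- to be acyclic.
acyclic? : ℕ → List (Subset n) → Bool
build?   : ℕ → ℕ → List (Subset n) → List (Subset n) → Bool

acyclic? zero    Fs = true
-- If every pass over the remaining faces places at least one of them, quadratically many steps
-- suffice. Running out of fuel only yields `false`.
acyclic? (suc d) Fs = build? d (length Fs ℕ.* length Fs) [] Fs

build? d _          Gs []       = true
build? d zero       Gs (_ ∷ _)  = false
build? d (suc fuel) Gs (F ∷ Fs) =
  if does (span? Gs F) then build? d fuel Gs Fs else
  -- The complex with `⊥` as its only face has homology in degree -1, so only nonempty simplices are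
  -- glued on. Mayer-Vietoris lowers the degree by one, hence `d` rather than `suc d` for the
  -- intersection.
  if not (does (F ⊆? ⊥)) ∧ acyclic? d (map (F ∩_) Gs)
  then build? d fuel (F ∷ Gs) Fs
  else build? d fuel Gs (Fs ++ F ∷ [])

-- Links, and the passage between cardinality and dimension.

linkFacets : Subset n → List (Subset n) → List (Subset n)
linkFacets F Gs = map (_∩ ∁ F) (filter (F ⊆?_) Gs)

∈link⇒ : ∀ {F σ : Subset n} {Gs} → σ ∩ F ≡ ⊥ → Span Gs (σ ∪ F) → Span (linkFacets F Gs) σ
∈link⇒ {F = F} {σ} σ∩F≡⊥ σ∪F∈Gs with find σ∪F∈Gs
... | G , G∈Gs , σ∪F⊆G = Any.map⁺ (lose (∈-filter⁺ (F ⊆?_) G∈Gs (λ {x} x∈F → σ∪F⊆G (q⊆p∪q σ F x∈F)))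
      λ x∈σ → x∈p∩q⁺ (σ∪F⊆G (p⊆p∪q F x∈σ)
                     , x∉p⇒x∈∁p (λ x∈F → ∉⊥ (subst (_ ∈ˢ_) σ∩F≡⊥ (x∈p∩q⁺ (x∈σ , x∈F))))))

∈link⇐ : ∀ {F σ : Subset n} {Gs} → Span (linkFacets F Gs) σ → σ ∩ F ≡ ⊥ × Span Gs (σ ∪ F)
∈link⇐ {F = F} {σ} {Gs} σ∈link with find (Any.map⁻ σ∈link)
... | G , G∈ , σ⊆G∖F =
      ⊆-antisym (λ x∈σ∩F → let x∈σ , x∈F = x∈p∩q⁻ σ F x∈σ∩F in
                  contradiction x∈F (x∈∁p⇒x∉p (proj₂ (x∈p∩q⁻ G (∁ F) (σ⊆G∖F x∈σ)))))
                (⊆-min _)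
    , lose (proj₁ G∈′) λ x∈σ∪F →
        [ (λ x∈σ → proj₁ (x∈p∩q⁻ G (∁ F) (σ⊆G∖F x∈σ))) , (λ x∈F → proj₂ G∈′ x∈F) ]′ (x∈p∪q⁻ σ F x∈σ∪F)
  where
  G∈′ = ∈-filter⁻ (F ⊆?_) {xs = Gs} G∈

∣σ∪F∣ : ∀ (σ F : Subset n) → σ ∩ F ≡ ⊥ → ∣ σ ∪ F ∣ ≡ ∣ σ ∣ ℕ.+ ∣ F ∣
∣σ∪F∣ []            []            _ = refl
∣σ∪F∣ (outside ∷ σ) (outside ∷ F) p = ∣σ∪F∣ σ F (Vec.∷-injectiveʳ p)
∣σ∪F∣ (outside ∷ σ) (inside  ∷ F) p =
  ≡.trans (cong suc (∣σ∪F∣ σ F (Vec.∷-injectiveʳ p))) (≡.sym (ℕ.+-suc _ _))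
∣σ∪F∣ (inside  ∷ σ) (outside ∷ F) p = cong suc (∣σ∪F∣ σ F (Vec.∷-injectiveʳ p))

m-1≡k-1⇒m≡k : ∀ {m k : ℕ} → + m ℤ.- 1ℤ ≡ + k ℤ.- 1ℤ → m ≡ k
m-1≡k-1⇒m≡k {zero}  {zero}  _ = refl
m-1≡k-1⇒m≡k {suc m} {suc k} e = cong suc (ℤ.+-injective e)

m-1≤k-1⇒m≤k : ∀ {m k : ℕ} → + m ℤ.- 1ℤ ℤ.≤ + k ℤ.- 1ℤ → m ℕ.≤ k
m-1≤k-1⇒m≤k {zero}          _ = z≤n
m-1≤k-1⇒m≤k {suc m} {suc k} (ℤ.+≤+ m≤k) = s≤s m≤k

[k+m]-1-m≡k-1 : ∀ k m → + (k ℕ.+ m) ℤ.- 1ℤ ℤ.- + m ≡ + k ℤ.- 1ℤ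
[k+m]-1-m≡k-1 k m = lemma (+ k) (+ m)
  where
  lemma : ∀ x y → x ℤ.+ y ℤ.- 1ℤ ℤ.- y ≡ x ℤ.- 1ℤ
  lemma = solve-∀

-- The Cohen-Macaulay condition ranges over all integer degrees; those below -1 carry no faces and
-- are split off here.
predecessor? : ∀ i → (∃[ k ] + k ℤ.- 1ℤ ≡ i) ⊎ (∀ k → + k ℤ.- 1ℤ ≢ i)
predecessor? (+ k)          = inj₁ (suc k , refl)
predecessor? -[1+ zero ]    = inj₁ (zero , refl)
predecessor? -[1+ suc j ]   = inj₂ λ { zero () ; (suc k) () }

-- The boundary operator over a field.

module _ {c ℓ} (K : Field c ℓ) where
  open Field K hiding (_-_; zero) renaming (refl to ≈-refl)
  open Homology K hiding (CohenMacaulay)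
  open import Algebra.Properties.CommutativeMonoid.Sum +-commutativeMonoid
    using (sum; sum-cong-≋; sum-replicate-zero)
  open import Algebra.Properties.Semiring.Sum semiring using (*-distribˡ-sum)
  open import Algebra.Properties.Semiring.Exp semiring using (_^_)
  open import Algebra.Properties.Ring ring
    using (-1*x≈-x; -‿+-comm; -0#≈0#; -‿involutive; +-cancelˡ)
  open import Algebra.Properties.CommutativeSemigroup +-commutativeSemigroup using (interchange)
  open import Relation.Binary.Reasoning.Setoid setoid

  private
    Coefficients : ℕ → Set c
    Coefficients n = Subset n → Carrier

  -- Together with `∂-in` this presents `∂` as a mapping cone over the remaining vertices, so that
  -- later identities follow by induction on `n` without handling signed sums. The first vertex
  -- always has position 0, hence sign +1.
  ∂-out : ∀ (a : Coefficients (suc n)) τ →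
          ∂ a (outside ∷ τ) ≈ a (inside ∷ τ) + ∂ (λ σ → a (outside ∷ σ)) τ
  ∂-out a τ = +-congʳ (trans (*-identityˡ _) (reflexive (cong (a ∘ (inside ∷_)) (∪-identityˡ τ))))

  -- The first vertex precedes all others, so its presence raises every position by one and flips
  -- every sign.
  ∂-in : ∀ (a : Coefficients (suc n)) τ →
         ∂ a (inside ∷ τ) ≈ - ∂ (λ σ → a (inside ∷ σ)) τ
  ∂-in a τ = begin
    0# + sum f             ≈⟨ +-identityˡ _ ⟩
    sum f                  ≈⟨ sum-cong-≋ f≈-g ⟩
    sum (λ v → - 1# * g v) ≈⟨ *-distribˡ-sum (- 1#) g ⟨
    - 1# * sum g           ≈⟨ -1*x≈-x _ ⟩
    - sum g                ∎
    where
    f g : Fin _ → Carrier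
    f v = if lookup τ v then 0# else (- 1#) ^ suc (before v τ) * a (inside ∷ ⁅ v ⁆ ∪ τ)
    g v = if lookup τ v then 0# else (- 1#) ^ before v τ * a (inside ∷ ⁅ v ⁆ ∪ τ)
    f≈-g : ∀ v → f v ≈ - 1# * g v
    f≈-g v with lookup τ v
    ... | inside  = sym (zeroʳ _)
    ... | outside = *-assoc _ _ _

  ∂-zero : ∀ (a : Coefficients n) τ → (∀ v → lookup τ v ≡ outside → a (⁅ v ⁆ ∪ τ) ≈ 0#) → ∂ a τ ≈ 0#
  ∂-zero {n} a τ a≈0 = trans (sum-cong-≋ f≈0) (sum-replicate-zero n)
    where
    f≈0 : ∀ v → (if lookup τ v then 0# else (- 1#) ^ before v τ * a (⁅ v ⁆ ∪ τ)) ≈ 0#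
    f≈0 v with lookup τ v in eq
    ... | inside  = ≈-refl
    ... | outside = trans (*-congˡ (a≈0 v eq)) (zeroʳ _)

  ∂-cong : ∀ {a b : Coefficients n} → (∀ σ → a σ ≈ b σ) → ∀ τ → ∂ a τ ≈ ∂ b τ
  ∂-cong a≈b []            = ≈-refl
  ∂-cong {a = a} {b} a≈b (outside ∷ τ) =
    trans (∂-out a τ) (trans (+-cong (a≈b _) (∂-cong (a≈b ∘ (outside ∷_)) τ)) (sym (∂-out b τ)))
  ∂-cong {a = a} {b} a≈b (inside  ∷ τ) =
    trans (∂-in a τ) (trans (-‿cong (∂-cong (a≈b ∘ (inside ∷_)) τ)) (sym (∂-in b τ)))

  ∂-+ : ∀ (a b : Coefficients n) τ → ∂ (λ σ → a σ + b σ) τ ≈ ∂ a τ + ∂ b τ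
  ∂-+ a b []            = sym (+-identityˡ _)
  ∂-+ a b (outside ∷ τ) = begin
    ∂ (λ σ → a σ + b σ) (outside ∷ τ) ≈⟨ ∂-out (λ σ → a σ + b σ) τ ⟩
    (x + y) + ∂ (λ σ → a₀ σ + b₀ σ) τ ≈⟨ +-congˡ (∂-+ a₀ b₀ τ) ⟩
    (x + y) + (∂ a₀ τ + ∂ b₀ τ)       ≈⟨ interchange x y _ _ ⟩
    (x + ∂ a₀ τ) + (y + ∂ b₀ τ)       ≈⟨ +-cong (∂-out a τ) (∂-out b τ) ⟨
    ∂ a (outside ∷ τ) + ∂ b (outside ∷ τ) ∎
    where
    x = a (inside ∷ τ)
    y = b (inside ∷ τ)
    a₀ = λ σ → a (outside ∷ σ)
    b₀ = λ σ → b (outside ∷ σ)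
  ∂-+ a b (inside  ∷ τ) = begin
    ∂ (λ σ → a σ + b σ) (inside ∷ τ)    ≈⟨ ∂-in (λ σ → a σ + b σ) τ ⟩
    - ∂ (λ σ → a₁ σ + b₁ σ) τ           ≈⟨ -‿cong (∂-+ a₁ b₁ τ) ⟩
    - (∂ a₁ τ + ∂ b₁ τ)                 ≈⟨ -‿+-comm _ _ ⟨
    - ∂ a₁ τ + - ∂ b₁ τ                 ≈⟨ +-cong (∂-in a τ) (∂-in b τ) ⟨
    ∂ a (inside ∷ τ) + ∂ b (inside ∷ τ) ∎
    where
    a₁ = λ σ → a (inside ∷ σ)
    b₁ = λ σ → b (inside ∷ σ)

  ∂-neg : ∀ (a : Coefficients n) τ → ∂ (λ σ → - a σ) τ ≈ - ∂ a τ
  ∂-neg a τ = sym (+-cancelˡ (∂ a τ) _ _ (begin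
    ∂ a τ + - ∂ a τ             ≈⟨ -‿inverseʳ _ ⟩
    0#                          ≈⟨ ∂-zero (λ σ → a σ + - a σ) τ (λ _ _ → -‿inverseʳ _) ⟨
    ∂ (λ σ → a σ + - a σ) τ     ≈⟨ ∂-+ a (λ σ → - a σ) τ ⟩
    ∂ a τ + ∂ (λ σ → - a σ) τ   ∎))

  -- Once the first vertex is split off, `∂ a₁` occurs twice with opposite signs; what remains is
  -- the claim for one vertex fewer.
  ∂∂≈0 : ∀ (a : Coefficients n) τ → ∂ (∂ a) τ ≈ 0#
  ∂∂≈0 a []            = ≈-refl
  ∂∂≈0 a (outside ∷ τ) = begin
    ∂ (∂ a) (outside ∷ τ)                      ≈⟨ ∂-out (∂ a) τ ⟩
    ∂ a (inside ∷ τ) + ∂ (∂ a ∘ (outside ∷_)) τ ≈⟨ +-cong (∂-in a τ) (∂-cong (∂-out a) τ) ⟩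
    - ∂ a₁ τ + ∂ (λ σ → a₁ σ + ∂ a₀ σ) τ       ≈⟨ +-congˡ (∂-+ a₁ (∂ a₀) τ) ⟩
    - ∂ a₁ τ + (∂ a₁ τ + ∂ (∂ a₀) τ)           ≈⟨ +-assoc _ _ _ ⟨
    (- ∂ a₁ τ + ∂ a₁ τ) + ∂ (∂ a₀) τ           ≈⟨ +-cong (-‿inverseˡ _) (∂∂≈0 a₀ τ) ⟩
    0# + 0#                                    ≈⟨ +-identityˡ _ ⟩
    0#                                         ∎
    where
    a₀ = λ σ → a (outside ∷ σ)
    a₁ = λ σ → a (inside ∷ σ)
  ∂∂≈0 a (inside  ∷ τ) = begin
    ∂ (∂ a) (inside ∷ τ)          ≈⟨ ∂-in (∂ a) τ ⟩
    - ∂ (∂ a ∘ (inside ∷_)) τ     ≈⟨ -‿cong (∂-cong (∂-in a) τ) ⟩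
    - ∂ (λ σ → - ∂ a₁ σ) τ        ≈⟨ -‿cong (∂-neg (∂ a₁) τ) ⟩
    - - ∂ (∂ a₁) τ                ≈⟨ -‿involutive _ ⟩
    ∂ (∂ a₁) τ                    ≈⟨ ∂∂≈0 a₁ τ ⟩
    0#                            ∎
    where
    a₁ = λ σ → a (inside ∷ σ)

  -- Chains and acyclicity, graded by cardinality.

  Chain : (Subset n → Set) → ℕ → Coefficients n → Set ℓ
  Chain P k a = ∀ σ → ¬ (P σ × ∣ σ ∣ ≡ k) → a σ ≈ 0#

  -- This is the vanishing of reduced homology in degree `k` - 1; grading by cardinality keeps
  -- degrees natural. A bare predicate `P` covers spans, simplices and links alike.
  Acyclic : (Subset n → Set) → ℕ → Set _
  Acyclic P k = ∀ a → Chain P k a → (∀ τ → ∂ a τ ≈ 0#) →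
                ∃[ b ] Chain P (suc k) b × (∀ σ → ∂ b σ ≈ a σ)

  Chain-mono : ∀ {P Q : Subset n → Set} {k a} → (∀ σ → P σ → Q σ) → Chain P k a → Chain Q k a
  Chain-mono P⇒Q ca σ ¬Q = ca σ λ (p , e) → ¬Q (P⇒Q σ p , e)

  Acyclic-resp : ∀ {P Q : Subset n → Set} {k} →
                 (∀ σ → P σ → Q σ) → (∀ σ → Q σ → P σ) → Acyclic P k → Acyclic Q k
  Acyclic-resp P⇒Q Q⇒P acy a ca ∂a≈0 =
    let b , cb , ∂b≈a = acy a (Chain-mono Q⇒P ca) ∂a≈0 in b , Chain-mono P⇒Q cb , ∂b≈a

  Acyclic-empty : ∀ {P : Subset n → Set} {k} → (∀ σ → ¬ (P σ × ∣ σ ∣ ≡ k)) → Acyclic P k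
  Acyclic-empty ¬P a ca _ =
    (λ _ → 0#) , (λ _ _ → ≈-refl) , λ σ → trans (∂-zero _ σ (λ _ _ → ≈-refl)) (sym (ca σ (¬P σ)))

  Chain-+ : ∀ {P : Subset n → Set} {k a b} → Chain P k a → Chain P k b → Chain P k (λ σ → a σ + b σ)
  Chain-+ ca cb σ ¬P = trans (+-cong (ca σ ¬P) (cb σ ¬P)) (+-identityˡ 0#)

  Chain-neg : ∀ {P : Subset n → Set} {k a} → Chain P k a → Chain P k (λ σ → - a σ)
  Chain-neg ca σ ¬P = trans (-‿cong (ca σ ¬P)) -0#≈0#

  Chain-∂ : ∀ {P : Subset n → Set} {k a} → (∀ {σ τ} → τ ⊆ σ → P σ → P τ) →
            Chain P (suc k) a → Chain P k (∂ a)
  Chain-∂ {P = P} {a = a} down ca τ ¬P = ∂-zero a τ λ v v∉τ → ca _ λ (p , e) →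
    ¬P (down (q⊆p∪q ⁅ v ⁆ τ) p , ℕ.suc-injective (≡.trans (≡.sym (∣insert∣ v τ v∉τ)) e))

  -- The simplex on F is a cone over its facet opposite to the first vertex.
  simplex-acyclic : ∀ {F : Subset n} k → Nonempty F → Acyclic (_⊆ F) k
  simplex-acyclic {F = inside ∷ F} k _ a ca ∂a≈0 = b , cb , ∂b≈a
    where
    b : Coefficients _
    b (outside ∷ σ) = 0#
    b (inside  ∷ σ) = a (outside ∷ σ)
    cb : Chain (_⊆ inside ∷ F) (suc k) b
    cb (outside ∷ σ) _  = ≈-refl
    cb (inside  ∷ σ) ¬P = ca _ λ (σ⊆F , e) → ¬P (in⊆in (drop-∷-⊆ σ⊆F) , cong suc e)
    ∂b≈a : ∀ σ → ∂ b σ ≈ a σ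
    ∂b≈a (outside ∷ σ) = begin
      ∂ b (outside ∷ σ)                  ≈⟨ ∂-out b σ ⟩
      a (outside ∷ σ) + ∂ (λ _ → 0#) σ   ≈⟨ +-congˡ (∂-zero _ σ (λ _ _ → ≈-refl)) ⟩
      a (outside ∷ σ) + 0#               ≈⟨ +-identityʳ _ ⟩
      a (outside ∷ σ)                    ∎
    -- On faces through the cone point, the cycle condition at `outside ∷ σ` turns `- ∂a₀` into
    -- `a (inside ∷ σ)`.
    ∂b≈a (inside  ∷ σ) = begin
      ∂ b (inside ∷ σ)                                ≈⟨ ∂-in b σ ⟩
      - ∂a₀                                           ≈⟨ +-identityˡ _ ⟨
      0# + - ∂a₀                                      ≈⟨ +-congʳ (∂a≈0 (outside ∷ σ)) ⟨
      ∂ a (outside ∷ σ) + - ∂a₀                       ≈⟨ +-congʳ (∂-out a σ) ⟩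
      (a (inside ∷ σ) + ∂a₀) + - ∂a₀                  ≈⟨ +-assoc _ _ _ ⟩
      a (inside ∷ σ) + (∂a₀ + - ∂a₀)                  ≈⟨ +-congˡ (-‿inverseʳ _) ⟩
      a (inside ∷ σ) + 0#                             ≈⟨ +-identityʳ _ ⟩
      a (inside ∷ σ)                                  ∎
      where
      ∂a₀ = ∂ (λ ρ → a (outside ∷ ρ)) σ
  simplex-acyclic {F = outside ∷ F} k (suc v , there v∈F) a ca ∂a≈0 = b , cb , ∂b≈a
    where
    a₁≈0 : ∀ σ → a (inside ∷ σ) ≈ 0#
    a₁≈0 σ = ca _ λ (σ⊆F , _) → contradiction (σ⊆F here) λ ()
    IH = simplex-acyclic k (v , v∈F) (λ σ → a (outside ∷ σ))
           (λ σ ¬P → ca _ λ (σ⊆F , e) → ¬P (drop-∷-⊆ σ⊆F , e))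
           λ τ → begin
             ∂ (λ σ → a (outside ∷ σ)) τ                    ≈⟨ +-identityˡ _ ⟨
             0# + ∂ (λ σ → a (outside ∷ σ)) τ               ≈⟨ +-congʳ (a₁≈0 τ) ⟨
             a (inside ∷ τ) + ∂ (λ σ → a (outside ∷ σ)) τ   ≈⟨ ∂-out a τ ⟨
             ∂ a (outside ∷ τ)                              ≈⟨ ∂a≈0 _ ⟩
             0#                                             ∎
    b₀ = proj₁ IH
    b : Coefficients _
    b (outside ∷ σ) = b₀ σ
    b (inside  ∷ σ) = 0#
    cb : Chain (_⊆ outside ∷ F) (suc k) b
    cb (outside ∷ σ) ¬P = proj₁ (proj₂ IH) σ λ (σ⊆F , e) → ¬P (out⊆ σ⊆F , e)
    cb (inside  ∷ σ) _  = ≈-refl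
    ∂b≈a : ∀ σ → ∂ b σ ≈ a σ
    ∂b≈a (outside ∷ σ) = trans (∂-out b σ) (trans (+-identityˡ _) (proj₂ (proj₂ IH) σ))
    ∂b≈a (inside  ∷ σ) = begin
      ∂ b (inside ∷ σ)       ≈⟨ ∂-in b σ ⟩
      - ∂ (λ _ → 0#) σ       ≈⟨ -‿cong (∂-zero _ σ (λ _ _ → ≈-refl)) ⟩
      - 0#                   ≈⟨ -0#≈0# ⟩
      0#                     ≈⟨ a₁≈0 σ ⟨
      a (inside ∷ σ)         ∎

  -- Mayer–Vietoris: a cycle splits as a₁ + a₂ with a₁ on the simplex F; the
  -- cycle ∂ a₁ lives on the intersection, bounds some c there, and a₁ - c and
  -- a₂ + c are cycles of the two parts.
  glue-acyclic : ∀ {F : Subset n} {Fs} k → Nonempty F →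
                 (∀ j → suc j ≡ k → Acyclic (Span (map (F ∩_) Fs)) j) →
                 Acyclic (Span Fs) k → Acyclic (Span (F ∷ Fs)) k
  -- Degree 0 concerns only the empty face, which lies in `F`, so the simplex on `F` already bounds
  -- the cycle.
  glue-acyclic {F = F} zero F≢∅ _ _ a ca ∂a≈0 =
    let b , cb , ∂b≈a = simplex-acyclic zero F≢∅ a
          (λ σ ¬P → ca σ λ (_ , e) → ¬P (∣σ∣≡0⇒σ⊆F {σ = σ} F e , e)) ∂a≈0
    in b , Chain-mono (λ _ → here) cb , ∂b≈a
  glue-acyclic {F = F} {Fs} (suc k) F≢∅ Γ-acyclic Fs-acyclic a ca ∂a≈0 =
      (λ σ → b₁ σ + b₂ σ)
    , Chain-+ (Chain-mono (λ _ → here) cb₁) (Chain-mono (λ _ → there) cb₂)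
    , λ σ → begin
        ∂ (λ ρ → b₁ ρ + b₂ ρ) σ          ≈⟨ ∂-+ b₁ b₂ σ ⟩
        ∂ b₁ σ + ∂ b₂ σ                  ≈⟨ +-cong (∂b₁ σ) (∂b₂ σ) ⟩
        (a₁ σ + - c′ σ) + (a₂ σ + c′ σ)  ≈⟨ interchange _ _ _ _ ⟩
        (a₁ σ + a₂ σ) + (- c′ σ + c′ σ)  ≈⟨ +-cong (a₁+a₂ σ) (-‿inverseˡ _) ⟩
        a σ + 0#                         ≈⟨ +-identityʳ _ ⟩
        a σ                              ∎
    where
    a₁ a₂ : Coefficients _
    a₁ σ = if does (σ ⊆? F) then a σ else 0#
    a₂ σ = if does (σ ⊆? F) then 0# else a σ
    a₁+a₂ : ∀ σ → a₁ σ + a₂ σ ≈ a σ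
    a₁+a₂ σ with does (σ ⊆? F)
    ... | true  = +-identityʳ _
    ... | false = +-identityˡ _
    ca₁ : Chain (_⊆ F) (suc k) a₁
    ca₁ σ ¬P with σ ⊆? F
    ... | yes σ⊆F = ca σ λ (_ , e) → ¬P ((λ {x} → σ⊆F {x}) , e)
    ... | no  _   = ≈-refl
    ca₂ : Chain (Span Fs) (suc k) a₂
    ca₂ σ ¬P with σ ⊆? F
    ... | yes _   = ≈-refl
    ... | no  σ⊈F = ca σ λ where
      (here σ⊆F , _)  → σ⊈F σ⊆F
      (there σ∈Fs , e) → ¬P (σ∈Fs , e)
    ∂a₁+∂a₂ : ∀ τ → ∂ a₁ τ + ∂ a₂ τ ≈ 0#
    ∂a₁+∂a₂ τ = trans (sym (∂-+ a₁ a₂ τ)) (trans (∂-cong a₁+a₂ τ) (∂a≈0 τ))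
    ∂a₁-chain : Chain (Span (map (F ∩_) Fs)) k (∂ a₁)
    ∂a₁-chain τ ¬P with τ ⊆? F
    ... | no  τ⊈F = Chain-∂ ⊆-trans ca₁ τ (λ (τ⊆F , _) → τ⊈F τ⊆F)
    -- Since `∂ a₁` is minus `∂ a₂`, it is supported on both parts, and a `τ` inside `F` and some
    -- `G` in `Fs` lies in `F ∩ G`.
    ... | yes τ⊆F = begin
      ∂ a₁ τ             ≈⟨ +-identityʳ _ ⟨
      ∂ a₁ τ + 0#        ≈⟨ +-congˡ (Chain-∂ Span-⊆ ca₂ τ λ (τ∈Fs , e) →
                              ¬P (Any.map⁺ (Any.map (λ τ⊆G {x} x∈τ → x∈p∩q⁺ (τ⊆F x∈τ , τ⊆G x∈τ)) τ∈Fs) , e)) ⟨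
      ∂ a₁ τ + ∂ a₂ τ    ≈⟨ ∂a₁+∂a₂ τ ⟩
      0#                 ∎
    Γ-bounds = Γ-acyclic k refl (∂ a₁) ∂a₁-chain (∂∂≈0 a₁)
    c′ = proj₁ Γ-bounds
    cc′ = proj₁ (proj₂ Γ-bounds)
    ∂c′ = proj₂ (proj₂ Γ-bounds)
    Γ⊆F : ∀ σ → Span (map (F ∩_) Fs) σ → σ ⊆ F
    Γ⊆F σ σ∈Γ with Any.satisfied (Any.map⁻ σ∈Γ)
    ... | G , σ⊆F∩G = λ x∈σ → proj₁ (x∈p∩q⁻ F G (σ⊆F∩G x∈σ))
    Γ⊆Fs : ∀ σ → Span (map (F ∩_) Fs) σ → Span Fs σ
    Γ⊆Fs σ σ∈Γ = Any.map (λ {G} σ⊆F∩G {x} x∈σ → proj₂ (x∈p∩q⁻ F G (σ⊆F∩G x∈σ))) (Any.map⁻ σ∈Γ)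
    B₁ = simplex-acyclic (suc k) F≢∅ (λ σ → a₁ σ + - c′ σ)
           (Chain-+ ca₁ (Chain-neg (Chain-mono Γ⊆F cc′)))
           λ τ → trans (∂-+ a₁ (λ σ → - c′ σ) τ) (trans (+-congˡ (trans (∂-neg c′ τ) (-‿cong (∂c′ τ)))) (-‿inverseʳ _))
    b₁ = proj₁ B₁
    cb₁ = proj₁ (proj₂ B₁)
    ∂b₁ = proj₂ (proj₂ B₁)
    B₂ = Fs-acyclic (λ σ → a₂ σ + c′ σ)
           (Chain-+ ca₂ (Chain-mono Γ⊆Fs cc′))
           λ τ → trans (∂-+ a₂ c′ τ) (trans (+-congˡ (∂c′ τ)) (trans (+-comm _ _) (∂a₁+∂a₂ τ)))
    b₂ = proj₁ B₂
    cb₂ = proj₁ (proj₂ B₂)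
    ∂b₂ = proj₂ (proj₂ B₂)

  Acyclic-↭ : ∀ {Fs Gs : List (Subset n)} {k} → Fs ↭ Gs →
              Acyclic (Span Fs) k → Acyclic (Span Gs) k
  Acyclic-↭ Fs↭Gs =
    Acyclic-resp (λ _ → Any-resp-↭ Fs↭Gs) (λ _ → Any-resp-↭ (↭-sym Fs↭Gs))

  -- Soundness of the acyclicity test.

  acyclic?-sound : ∀ d (Fs : List (Subset n)) → acyclic? d Fs ≡ true →
                   ∀ k → k ℕ.< d → Acyclic (Span Fs) k
  -- Follows the run of `build?` with the acyclicity of `Gs` as invariant: a skipped face adds
  -- nothing to the span, a glued one preserves the invariant by `glue-acyclic`, and a postponed one
  -- only permutes the list.
  build?-sound : ∀ d fuel (Gs Fs : List (Subset n)) → build? d fuel Gs Fs ≡ true →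
                 (∀ k → k ℕ.< suc d → Acyclic (Span Gs) k) →
                 ∀ k → k ℕ.< suc d → Acyclic (Span (Gs ++ Fs)) k

  -- The construction starts from the void complex, which lacks even the empty face and so carries
  -- no nonzero chain.
  acyclic?-sound (suc d) Fs ok =
    build?-sound d (length Fs ℕ.* length Fs) [] Fs ok (λ _ _ → Acyclic-empty λ _ ())

  build?-sound d _ Gs [] _ acy k k<d = Acyclic-↭ (++-comm [] Gs) (acy k k<d)
  build?-sound d (suc fuel) Gs (F ∷ Fs) ok acy k k<d with span? Gs F
  ... | yes F∈Gs = Acyclic-↭ (↭-sym (shift F Gs Fs))
        (Acyclic-resp (λ _ → there)
          (λ σ → λ where
            (here σ⊆F) → Any.++⁺ˡ (Span-⊆ σ⊆F F∈Gs)
            (there σ∈) → σ∈)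
          (build?-sound d fuel Gs Fs ok acy k k<d))
  ... | no _ with F ⊆? ⊥ | acyclic? d (map (F ∩_) Gs) in Γ-ok
  ...   | yes _   | _     = Acyclic-↭ (++⁺ˡ Gs (++-comm Fs _)) (build?-sound d fuel Gs _ ok acy k k<d)
  ...   | no _    | false = Acyclic-↭ (++⁺ˡ Gs (++-comm Fs _)) (build?-sound d fuel Gs _ ok acy k k<d)
  ...   | no F⊈⊥ | true  = Acyclic-↭ (↭-sym (shift F Gs Fs))
          (build?-sound d fuel (F ∷ Gs) Fs ok
            (λ j j<d → glue-acyclic j (⊈⊥⇒Nonempty F⊈⊥)
              (λ i 1+i≡j → acyclic?-sound d _ Γ-ok i (ℕ.≤-pred (subst (ℕ._< suc d) (≡.sym 1+i≡j) j<d)))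
              (acy j j<d))
            k k<d)

  -- From acyclic links to Cohen-Macaulayness.

  Acyclic⇒H̃Vanishes : ∀ (Δ : Complex n) k → Acyclic (Face Δ) k →
                       H̃Vanishes Δ (+ k ℤ.- 1ℤ)
  Acyclic⇒H̃Vanishes Δ k acy a ca ∂a≈0 =
    let b , cb , ∂b≈a = acy a (λ σ ¬P → ca σ λ (p , e) → ¬P (p , m-1≡k-1⇒m≡k e)) ∂a≈0
    in b , (λ σ ¬P → cb σ λ (p , e) → ¬P (p , ≡.trans (cong (λ m → + m ℤ.- 1ℤ) e) (suck≡ k))) , ∂b≈a
    where
    suck≡ : ∀ k → + suc k ℤ.- 1ℤ ≡ (+ k ℤ.- 1ℤ) ℤ.+ 1ℤ
    suck≡ zero    = refl
    suck≡ (suc k) = cong +_ (≡.sym (ℕ.+-comm k 1))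

  H̃Vanishes-noFace : ∀ (Δ : Complex n) i → (∀ σ → ¬ (Face Δ σ × dim σ ≡ i)) → H̃Vanishes Δ i
  H̃Vanishes-noFace Δ i ¬F a ca _ =
    (λ _ → 0#) , (λ _ _ → ≈-refl) , λ σ → trans (∂-zero _ σ (λ _ _ → ≈-refl)) (sym (ca σ (¬F σ)))

  -- The link of `F` has no faces of cardinality above `d ∸ ∣ F ∣`, and that top degree is exempt,
  -- so only the degrees certified by `acyclic?` remain. The test mentions no field: one evaluation
  -- serves every `K`.
  cohenMacaulay : ∀ (Δ : Complex n) {Fs} d → Generates Fs Δ →
    HasDim Δ (+ d ℤ.- 1ℤ) →
    (∀ F → Face Δ F → acyclic? (d ℕ.∸ ∣ F ∣) (linkFacets F Fs) ≡ true) →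
    CohenMacaulay K Δ
  cohenMacaulay Δ {Fs} d (to , from) hasDim ok = d , hasDim , vanish
    where
    faceBound : ∀ F G → Face (link Δ F) G → ∣ G ∣ ℕ.+ ∣ F ∣ ℕ.≤ d
    faceBound F G (_ , G∩F≡⊥ , G∪F∈Δ) = subst (ℕ._≤ d) (∣σ∪F∣ G F G∩F≡⊥)
      (m-1≤k-1⇒m≤k (proj₂ hasDim _ G∪F∈Δ))

    linkAcyclic : ∀ F → Face Δ F → ∀ k → k ℕ.< d ℕ.∸ ∣ F ∣ → Acyclic (Face (link Δ F)) k
    linkAcyclic F F∈Δ k k< = Acyclic-resp
      (λ σ σ∈ → let σ∩F≡⊥ , σ∪F∈ = ∈link⇐ {F = F} {Gs = Fs} σ∈ in
        downClosed Δ (p⊆p∪q F) (from σ∪F∈) , σ∩F≡⊥ , from σ∪F∈)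
      (λ σ (_ , σ∩F≡⊥ , σ∪F∈) → ∈link⇒ {F = F} σ∩F≡⊥ (to σ∪F∈))
      (acyclic?-sound _ _ (ok F F∈Δ) k k<)

    vanish : ∀ F → Face Δ F → ∀ i → i ≢ + d ℤ.- 1ℤ ℤ.- + ∣ F ∣ → H̃Vanishes (link Δ F) i
    vanish F F∈Δ i i≢ with predecessor? i
    ... | inj₂ i≢k-1 = H̃Vanishes-noFace (link Δ F) i λ σ (_ , e) → i≢k-1 ∣ σ ∣ e
    ... | inj₁ (k , refl) with ℕ.<-cmp (k ℕ.+ ∣ F ∣) d
    ...   | tri< k+F<d _ _ = Acyclic⇒H̃Vanishes (link Δ F) k (linkAcyclic F F∈Δ k (ℕ.m+n≤o⇒m≤o∸n (suc k) k+F<d))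
    ...   | tri≈ _ refl _ = contradiction (≡.sym ([k+m]-1-m≡k-1 k ∣ F ∣)) i≢
    ...   | tri> _ _ d<k+F = H̃Vanishes-noFace (link Δ F) (+ k ℤ.- 1ℤ) λ σ (σ∈ , e) →
              ℕ.<⇒≱ d<k+F (subst (λ m → m ℕ.+ ∣ F ∣ ℕ.≤ d) (m-1≡k-1⇒m≡k e) (faceBound F σ σ∈))

-- Partitions into intervals

infix 4 _≟_
_≟_ : DecidableEquality (Subset n)
_≟_ = Vec.≡-dec Bool._≟_

interval : Subset n → Subset n → List (Subset n)
interval []            []            = [] ∷ []
interval (outside ∷ R) (outside ∷ F) = map (outside ∷_) (interval R F)
interval (outside ∷ R) (inside  ∷ F) = map (outside ∷_) (interval R F) ++ map (inside ∷_) (interval R F)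
interval (inside  ∷ R) (outside ∷ F) = []
interval (inside  ∷ R) (inside  ∷ F) = map (inside ∷_) (interval R F)

∈-interval⁺ : ∀ {R F G : Subset n} → R ⊆ G → G ⊆ F → G ∈ interval R F
∈-interval⁺ {R = []}          {[]}          {[]}          R⊆G G⊆F = here refl
∈-interval⁺ {R = outside ∷ R} {outside ∷ F} {outside ∷ G} R⊆G G⊆F =
  ∈-map⁺ _ (∈-interval⁺ (drop-∷-⊆ R⊆G) (drop-∷-⊆ G⊆F))
∈-interval⁺ {R = outside ∷ R} {inside ∷ F}  {outside ∷ G} R⊆G G⊆F =
  ∈-++⁺ˡ (∈-map⁺ _ (∈-interval⁺ (drop-∷-⊆ R⊆G) (drop-∷-⊆ G⊆F)))
∈-interval⁺ {R = outside ∷ R} {inside ∷ F}  {inside ∷ G}  R⊆G G⊆F =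
  ∈-++⁺ʳ _ (∈-map⁺ _ (∈-interval⁺ (drop-∷-⊆ R⊆G) (drop-∷-⊆ G⊆F)))
∈-interval⁺ {R = inside ∷ R}  {inside ∷ F}  {inside ∷ G}  R⊆G G⊆F =
  ∈-map⁺ _ (∈-interval⁺ (drop-∷-⊆ R⊆G) (drop-∷-⊆ G⊆F))
∈-interval⁺ {R = inside ∷ R}  {_}           {outside ∷ G} R⊆G G⊆F = contradiction (R⊆G here) λ ()
∈-interval⁺ {R = _}           {outside ∷ F} {inside ∷ G}  R⊆G G⊆F = contradiction (G⊆F here) λ ()

∈-interval⁻ : ∀ (R F : Subset n) {G} → G ∈ interval R F → R ⊆ G × G ⊆ F
∈-interval⁻ []            []            (here refl) = (λ ()) , (λ ())
∈-interval⁻ (outside ∷ R) (outside ∷ F) G∈ with ∈-map⁻ _ G∈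
... | G , G∈′ , refl = let R⊆G , G⊆F = ∈-interval⁻ R F G∈′ in out⊆ R⊆G , out⊆ G⊆F
∈-interval⁻ (outside ∷ R) (inside ∷ F)  G∈ with ∈-++⁻ (map (outside ∷_) (interval R F)) G∈
... | inj₁ G∈ₒ with G , G∈′ , refl ← ∈-map⁻ _ G∈ₒ =
  let R⊆G , G⊆F = ∈-interval⁻ R F G∈′ in out⊆ R⊆G , out⊆ G⊆F
... | inj₂ G∈ᵢ with G , G∈′ , refl ← ∈-map⁻ _ G∈ᵢ =
  let R⊆G , G⊆F = ∈-interval⁻ R F G∈′ in out⊆ R⊆G , in⊆in G⊆F
∈-interval⁻ (inside ∷ R)  (inside ∷ F)  G∈ with ∈-map⁻ _ G∈
... | G , G∈′ , refl = let R⊆G , G⊆F = ∈-interval⁻ R F G∈′ in in⊆in R⊆G , in⊆in G⊆F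

interval-unique : ∀ (R F : Subset n) → Unique (interval R F)
interval-unique []            []            = [] ∷ []
interval-unique (outside ∷ R) (outside ∷ F) = Unique.map⁺ Vec.∷-injectiveʳ (interval-unique R F)
interval-unique (outside ∷ R) (inside ∷ F)  =
  Unique.++⁺ (Unique.map⁺ Vec.∷-injectiveʳ (interval-unique R F))
             (Unique.map⁺ Vec.∷-injectiveʳ (interval-unique R F))
             λ (G∈ₒ , G∈ᵢ) → case (∈-map⁻ _ G∈ₒ) (∈-map⁻ _ G∈ᵢ)
  where
  case : ∀ {xs ys : List (Subset _)} {G} → ∃[ p ] p ∈ xs × G ≡ outside ∷ p →
         ∃[ q ] q ∈ ys × G ≡ inside ∷ q → Empty.⊥
  case (_ , _ , refl) (_ , _ , ())
interval-unique (inside ∷ R)  (outside ∷ F) = []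
interval-unique (inside ∷ R)  (inside ∷ F)  = Unique.map⁺ Vec.∷-injectiveʳ (interval-unique R F)

faces : List (Subset n) → List (Subset n)
faces Fs = deduplicate _≟_ (concatMap (interval ⊥) Fs)

faces-unique : ∀ (Fs : List (Subset n)) → Unique (faces Fs)
faces-unique Fs = deduplicate-! (concatMap (interval ⊥) Fs)
  where open import Data.List.Relation.Unary.Unique.DecPropositional.Properties _≟_ using (deduplicate-!)

∈-faces⁺ : ∀ {Fs} {σ : Subset n} → Span Fs σ → σ ∈ faces Fs
∈-faces⁺ σ∈Fs = ∈-deduplicate⁺ _≟_ (∈-concatMap⁺ (interval ⊥) (Any.map (∈-interval⁺ (⊆-min _)) σ∈Fs))

∈-faces⁻ : ∀ {Fs} {σ : Subset n} → σ ∈ faces Fs → Span Fs σ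
∈-faces⁻ {Fs = Fs} σ∈ = Any.map (proj₂ ∘ ∈-interval⁻ ⊥ _)
  (∈-concatMap⁻ (interval ⊥) (∈-deduplicate⁻ _≟_ (concatMap (interval ⊥) Fs) σ∈))

-- Weights of faces and the h-vector.

weight : (ℕ → ℕ) → List (Subset n) → ℕ
weight w σs = ℕ.sum (map (w ∘ ∣_∣) σs)

weight-++ : ∀ w (σs τs : List (Subset n)) → weight w (σs ++ τs) ≡ weight w σs ℕ.+ weight w τs
weight-++ w σs τs = ≡.trans (cong ℕ.sum (map-++ _ σs τs)) (ℕ.sum-++ (map (w ∘ ∣_∣) σs) _)

-- With g = w⁺ - w⁻ = (-3, 2, -1, 0, 1) on faces of cardinality 0, …, 4, the
-- sum of g over [ R , F ] is 0 for ∣ R ∣ ≤ 2 and 1 for ∣ R ∣ = 3, 4.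
w⁺ w⁻ : ℕ → ℕ
w⁺ 1 = 2
w⁺ 4 = 1
w⁺ _ = 0
w⁻ 0 = 3
w⁻ 2 = 1
w⁻ _ = 0

excess : ℕ → ℕ
excess (suc (suc (suc _))) = 1
excess _                   = 0

excess≡0⇒≤2 : ∀ {k} → excess k ≡ 0 → k ℕ.≤ 2
excess≡0⇒≤2 {zero}           _ = z≤n
excess≡0⇒≤2 {suc zero}       _ = s≤s z≤n
excess≡0⇒≤2 {suc (suc zero)} _ = s≤s (s≤s z≤n)

-- For a 3-dimensional complex, `g` paired with the f-vector is h₃ + h₄, so the first component says
-- that this sum is 0. Separate `w⁺` and `w⁻` keep the equations in `ℕ`.
WeightsBalance : List (Subset n) → Set
WeightsBalance Fs =
    weight w⁺ (faces Fs) ≡ weight w⁻ (faces Fs)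
  × All (λ F → All (λ R → weight w⁺ (interval R F) ≡ weight w⁻ (interval R F) ℕ.+ excess ∣ R ∣)
                   (interval ⊥ F)) Fs

weightsBalance? : ∀ (Fs : List (Subset n)) → Dec (WeightsBalance Fs)
weightsBalance? Fs = total? (faces Fs) ×-dec All.all? (λ F → All.all? (λ R → _ ℕ.≟ _) (interval ⊥ F)) Fs
  where
  total? : ∀ (σs : List (Subset _)) → Dec (weight w⁺ σs ≡ weight w⁻ σs)
  total? σs = _ ℕ.≟ _

-- (F , R) stands for the interval [ R , F ].
Row : ℕ → Set
Row n = Subset n × Subset n

Covers : Subset n → Row n → Set
Covers G (F , R) = R ⊆ G × G ⊆ F

covers? : ∀ (G : Subset n) r → Dec (Covers G r)
covers? G (F , R) = (R ⊆? G) ×-dec (G ⊆? F)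

-- A face common to both intervals exists exactly when `R ∪ R′ ⊆ F ∩ F′`. The second alternative
-- keeps a chosen row available for later faces in the same interval.
Compatible : Row n → Row n → Set
Compatible (F , R) (F′ , R′) = ¬ (R ∪ R′ ⊆ F ∩ F′) ⊎ (F ≡ F′ × R ≡ R′)

compatible? : ∀ (r s : Row n) → Dec (Compatible r s)
compatible? (F , R) (F′ , R′) = ¬? (R ∪ R′ ⊆? F ∩ F′) ⊎-dec ((F ≟ F′) ×-dec (R ≟ R′))

-- Exhaustive search for pairwise disjoint intervals covering the given faces,
-- branching over the interval that contains the next face.
Refuted : List (Subset n) → List (Row n) → Set
Refuted []       rows = Empty.⊥
Refuted (G ∷ Gs) rows =
  All (λ r → Refuted Gs (filter (compatible? r) rows)) (filter (covers? G) rows)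

refuted? : ∀ (Gs : List (Subset n)) rows → Dec (Refuted Gs rows)
refuted? []       rows = no id
refuted? (G ∷ Gs) rows = All.all? (λ r → refuted? Gs (filter (compatible? r) rows)) _

rowsAvoiding : List (Subset n) → List (Subset n) → List (Row n)
rowsAvoiding Ts Fs =
  filter (λ r → All.all? (λ T → ¬? (covers? T r)) Ts)
    (concatMap (λ F → map (F ,_) (filter (λ R → ∣ R ∣ ℕ.≤? 2) (interval ⊥ F))) Fs)

-- A certificate that the intervals of `Hs` must cover some face of `Ts`. By `local`, only facets in
-- `Hs` can cover the faces `Gs`, which confines the search to `Hs`.
record Forces (Fs Hs Ts Gs : List (Subset n)) : Set where
  constructor forces
  field
    Hs⊆Fs   : All (_∈ Fs) Hs
    Gs⊆Δ    : All (Span Fs) Gs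
    local   : All (λ G → All (λ F → ¬ (G ⊆ F) ⊎ F ∈ Hs) Fs) Gs
    refuted : Refuted Gs (rowsAvoiding Ts Hs)

forces? : ∀ (Fs Hs Ts Gs : List (Subset n)) → Dec (Forces Fs Hs Ts Gs)
forces? Fs Hs Ts Gs = map′ (λ (a , b , c , d) → forces a b c d) (λ (forces a b c d) → a , b , c , d)
  (All.all? (λ F → Any.any? (F ≟_) Fs) Hs ×-dec All.all? (span? Fs) Gs
    ×-dec All.all? (λ G → All.all? (λ F → ¬? (G ⊆? F) ⊎-dec Any.any? (F ≟_) Hs) Fs) Gs
    ×-dec refuted? Gs (rowsAvoiding Ts Hs))

sum≡0⇒All : ∀ {A : Set} (f : A → ℕ) xs → ℕ.sum (map f xs) ≡ 0 → All (λ x → f x ≡ 0) xs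
sum≡0⇒All f []       _ = []
sum≡0⇒All f (x ∷ xs) e = ℕ.m+n≡0⇒m≡0 (f x) e ∷ sum≡0⇒All f xs (ℕ.m+n≡0⇒n≡0 (f x) e)

-- Consequences of a given partition.

module Partition
  (Fs : List (Subset n)) (R : Subset n → Subset n)
  (R⊆ : ∀ {F} → F ∈ Fs → R F ⊆ F)
  (cover : ∀ G → Span Fs G → ∃[ F ] F ∈ Fs × Covers G (F , R F))
  (coverer-unique : ∀ {F F′ G} → F ∈ Fs → F′ ∈ Fs →
                    Covers G (F , R F) → Covers G (F′ , R F′) → F ≡ F′)
  where

  intervals : List (Subset n) → List (Subset n)
  intervals = concatMap λ F → interval (R F) F

  intervals-unique : ∀ {Gs} → (∀ {F} → F ∈ Gs → F ∈ Fs) → Unique Gs → Unique (intervals Gs)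
  intervals-unique {[]}     _     _            = []
  intervals-unique {F ∷ Gs} Gs⊆Fs (F∉Gs ∷ Gs!) =
    Unique.++⁺ (interval-unique (R F) F) (intervals-unique (Gs⊆Fs ∘ there) Gs!)
      λ (G∈F , G∈Gs) → let F′ , F′∈Gs , G∈F′ = find (∈-concatMap⁻ (λ F → interval (R F) F) {xs = Gs} G∈Gs) in
        contradiction
          (coverer-unique (Gs⊆Fs (here refl)) (Gs⊆Fs (there F′∈Gs))
            (∈-interval⁻ (R F) F G∈F) (∈-interval⁻ (R F′) F′ G∈F′))
          (All.lookup F∉Gs F′∈Gs)

  -- Both lists are free of duplicates and have the same elements, so they are permutations of each
  -- other.
  weight-intervals : ∀ w → Unique Fs → weight w (intervals Fs) ≡ weight w (faces Fs)
  weight-intervals w Fs! = ℕ.sum-↭ (map⁺ (w ∘ ∣_∣) (∼bag⇒↭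
    (unique∧set⇒bag (intervals-unique id Fs!) (faces-unique Fs) (mk⇔
      (λ G∈ → let F , F∈Fs , G∈F = find (∈-concatMap⁻ (λ F → interval (R F) F) {xs = Fs} G∈) in
        ∈-faces⁺ (lose F∈Fs (proj₂ (∈-interval⁻ (R F) F G∈F))))
      (λ G∈ → let F , F∈Fs , R⊆G , G⊆F = cover _ (∈-faces⁻ {Fs = Fs} G∈) in
        ∈-concatMap⁺ (λ F → interval (R F) F) (lose F∈Fs (∈-interval⁺ R⊆G G⊆F)))))))

  -- Adding the local balances over the partition, the excesses sum to the total of `w⁺` minus `w⁻`
  -- over all faces, which is 0; hence each excess is 0.
  small : Unique Fs → WeightsBalance Fs → All (λ F → ∣ R F ∣ ℕ.≤ 2) Fs
  small Fs! (total , local) =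
    All.map excess≡0⇒≤2 (sum≡0⇒All (excess ∘ ∣_∣ ∘ R) Fs
      (≡.sym (ℕ.+-cancelˡ-≡ (weight w⁻ (intervals Fs)) _ _ (begin
        weight w⁻ (intervals Fs) ℕ.+ 0   ≡⟨ ℕ.+-identityʳ _ ⟩
        weight w⁻ (intervals Fs)         ≡⟨ weight-intervals w⁻ Fs! ⟩
        weight w⁻ (faces Fs)             ≡⟨ total ⟨
        weight w⁺ (faces Fs)             ≡⟨ weight-intervals w⁺ Fs! ⟨
        weight w⁺ (intervals Fs)         ≡⟨ balance Fs id ⟩
        weight w⁻ (intervals Fs) ℕ.+ ℕ.sum (map (excess ∘ ∣_∣ ∘ R) Fs) ∎))))
    where
    open ≡.≡-Reasoning
    balance : ∀ Gs → (∀ {F} → F ∈ Gs → F ∈ Fs) →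
              weight w⁺ (intervals Gs) ≡ weight w⁻ (intervals Gs) ℕ.+ ℕ.sum (map (excess ∘ ∣_∣ ∘ R) Gs)
    balance []       _     = refl
    balance (F ∷ Gs) Gs⊆Fs = begin
      weight w⁺ (interval (R F) F ++ intervals Gs)
        ≡⟨ weight-++ w⁺ (interval (R F) F) _ ⟩
      weight w⁺ (interval (R F) F) ℕ.+ weight w⁺ (intervals Gs)
        ≡⟨ cong₂ ℕ._+_
             (All.lookup (All.lookup local F∈Fs) (∈-interval⁺ (⊆-min _) (R⊆ F∈Fs)))
             (balance Gs (Gs⊆Fs ∘ there)) ⟩
      (a ℕ.+ x) ℕ.+ (b ℕ.+ y)
        ≡⟨ interchange a x b y ⟩
      (a ℕ.+ b) ℕ.+ (x ℕ.+ y)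
        ≡⟨ cong (ℕ._+ (x ℕ.+ y)) (weight-++ w⁻ (interval (R F) F) _) ⟨
      weight w⁻ (interval (R F) F ++ intervals Gs) ℕ.+ (x ℕ.+ y) ∎
      where
      open import Algebra.Properties.CommutativeSemigroup ℕ.+-commutativeSemigroup using (interchange)
      F∈Fs = Gs⊆Fs (here refl)
      a = weight w⁻ (interval (R F) F)
      b = weight w⁻ (intervals Gs)
      x = excess ∣ R F ∣
      y = ℕ.sum (map (excess ∘ ∣_∣ ∘ R) Gs)

  Covered : List (Subset n) → Subset n → Set
  Covered Hs T = Any (λ F → Covers T (F , R F)) Hs

  Covered-disjoint : ∀ {Hs Hs′ T} → All (_∈ Fs) Hs → All (_∈ Fs) Hs′ →
                     All (λ F → All (F ≢_) Hs′) Hs → Covered Hs T → ¬ Covered Hs′ T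
  Covered-disjoint Hs⊆Fs Hs′⊆Fs disjoint T∈Hs T∈Hs′ =
    let F  , F∈Hs   , cF  = find T∈Hs
        F′ , F′∈Hs′ , cF′ = find T∈Hs′
    in All.lookup (All.lookup disjoint F∈Hs) F′∈Hs′
         (coverer-unique (All.lookup Hs⊆Fs F∈Hs) (All.lookup Hs′⊆Fs F′∈Hs′) cF cF′)

  compatible : ∀ {F F′} → F ∈ Fs → F′ ∈ Fs → Compatible (F , R F) (F′ , R F′)
  compatible {F} {F′} F∈Fs F′∈Fs with R F ∪ R F′ ⊆? F ∩ F′
  ... | no  disjoint = inj₁ disjoint
  ... | yes meet⊆ = inj₂ (F≡F′ , cong R F≡F′)
    where
    -- The face lying in both intervals is `R F ∪ R F′`.
    F≡F′ = coverer-unique F∈Fs F′∈Fs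
      ((λ x∈ → p⊆p∪q (R F′) x∈) , (λ x∈ → p∩q⊆p F F′ (meet⊆ x∈)))
      ((λ x∈ → q⊆p∪q (R F) (R F′) x∈) , (λ x∈ → p∩q⊆q F F′ (meet⊆ x∈)))

  -- The partition itself picks a branch of the search: at each face, take the row that covers it.
  -- Its rows survive every filter, so this branch reaches the end of the list, where `Refuted` is
  -- empty.
  ¬Refuted : ∀ {Hs} Gs rows → All (_∈ Fs) Hs → All (λ F → (F , R F) ∈ rows) Hs →
             All (Covered Hs) Gs → ¬ Refuted Gs rows
  ¬Refuted (G ∷ Gs) rows Hs⊆Fs Hs⊆rows (G∈Hs ∷ Gs∈Hs) refuted =
    let F , F∈Hs , cF = find G∈Hs in
    ¬Refuted Gs _ Hs⊆Fs
      (All.tabulate λ F′∈Hs → ∈-filter⁺ (compatible? (F , R F)) (All.lookup Hs⊆rows F′∈Hs)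
        (compatible (All.lookup Hs⊆Fs F∈Hs) (All.lookup Hs⊆Fs F′∈Hs)))
      Gs∈Hs
      (All.lookup refuted (∈-filter⁺ (covers? G) (All.lookup Hs⊆rows F∈Hs) cF))

  -- If no face of `Ts` were covered, the rows of the partition over `Hs` would all be candidates,
  -- and the search could not fail.
  forced : ∀ {Hs Ts Gs} → All (λ F → ∣ R F ∣ ℕ.≤ 2) Fs → Forces Fs Hs Ts Gs → Any (Covered Hs) Ts
  forced {Hs} {Ts} {Gs} R-small (forces Hs⊆Fs Gs⊆Δ local refuted)
    with Any.any? (λ T → Any.any? (λ F → covers? T (F , R F)) Hs) Ts
  ... | yes covered = covered
  ... | no ¬covered = Empty.⊥-elim (¬Refuted Gs _ Hs⊆Fs Hs⊆rows Gs∈Hs refuted)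
    where
    Hs⊆rows : All (λ F → (F , R F) ∈ rowsAvoiding Ts Hs) Hs
    Hs⊆rows = All.tabulate λ {F} F∈Hs →
      let F∈Fs = All.lookup Hs⊆Fs F∈Hs in
      ∈-filter⁺ _
        (∈-concatMap⁺ _ (lose F∈Hs (∈-map⁺ (F ,_)
          (∈-filter⁺ (λ R → ∣ R ∣ ℕ.≤? 2) (∈-interval⁺ (⊆-min _) (R⊆ F∈Fs)) (All.lookup R-small F∈Fs)))))
        (All.tabulate λ T∈Ts cT → ¬covered (lose T∈Ts (lose F∈Hs cT)))
    Gs∈Hs : All (Covered Hs) Gs
    Gs∈Hs = All.tabulate λ {G} G∈Gs →
      let F , F∈Fs , cF = cover G (All.lookup Gs⊆Δ G∈Gs) in
      [ (λ G⊈F → contradiction (λ {x} → proj₂ cF {x}) G⊈F) , (λ F∈Hs → lose F∈Hs cF) ]′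
        (All.lookup (All.lookup local G∈Gs) F∈Fs)

-- Properties of a complex read off its list of facets.

face : List (Fin n) → Subset n
face F = ⋃ (map ⁅_⁆ F)

⟨⟩-generated : ∀ (Fs : List (List (Fin n))) → Generates (map face Fs) ⟨ Fs ⟩
⟨⟩-generated Fs = Any.map⁺ , Any.map⁻

Pure : ℕ → List (Subset n) → Set
Pure d = All λ F → ∣ F ∣ ≡ d

pure? : ∀ d (Fs : List (Subset n)) → Dec (Pure d Fs)
pure? d = All.all? λ F → ∣ F ∣ ℕ.≟ d

hasDim : ∀ (Δ : Complex n) {d F Fs} → Generates (F ∷ Fs) Δ → Pure d (F ∷ Fs) → HasDim Δ (+ d ℤ.- 1ℤ)
hasDim Δ {d} {F} (Δ⇒Fs , Fs⇒Δ) pure@(∣F∣≡d ∷ _) =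
    (F , Fs⇒Δ (here ⊆-refl) , cong (λ m → + m ℤ.- 1ℤ) ∣F∣≡d)
  , λ σ σ∈Δ → let G , G∈Fs , σ⊆G = find (Δ⇒Fs σ∈Δ) in
      ℤ.+-monoˡ-≤ (ℤ.- 1ℤ) (ℤ.+≤+ (subst (∣ σ ∣ ℕ.≤_) (All.lookup pure G∈Fs) (p⊆q⇒∣p∣≤∣q∣ σ⊆G)))

ofCardinality : ℕ → List (Subset n) → List (Subset n)
ofCardinality k = filter λ σ → ∣ σ ∣ ℕ.≟ k

f-vector : ∀ d → List (Subset n) → Vec ℕ (suc d)
f-vector d σs = Vec.tabulate λ j → length (ofCardinality (toℕ j) σs)

hasFVector : ∀ (Δ : Complex n) {d Fs} {f : Vec ℕ (suc d)} → Generates Fs Δ →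
             HasDim Δ (+ d ℤ.- 1ℤ) → f-vector d (faces Fs) ≡ f → HasFVector Δ f
hasFVector Δ {d} {Fs} (Δ⇒Fs , Fs⇒Δ) dimΔ refl = dimΔ , λ j →
    ofCardinality (toℕ j) (faces Fs)
  , Unique.filter⁺ (λ σ → ∣ σ ∣ ℕ.≟ toℕ j) (faces-unique Fs)
  , (λ σ → mk⇔
      (λ σ∈ → let σ∈faces , e = ∈-filter⁻ (λ σ → ∣ σ ∣ ℕ.≟ toℕ j) {xs = faces Fs} σ∈ in
        Fs⇒Δ (∈-faces⁻ {Fs = Fs} σ∈faces) , cong (λ m → + m ℤ.- 1ℤ) e)
      (λ (σ∈Δ , e) → ∈-filter⁺ (λ σ → ∣ σ ∣ ℕ.≟ toℕ j) (∈-faces⁺ (Δ⇒Fs σ∈Δ)) (m-1≡k-1⇒m≡k e)))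
  , ≡.sym (Vec.lookup∘tabulate (λ j → length (ofCardinality (toℕ j) (faces Fs))) j)

Proper : ∀ {d} → List (Subset n) → (Fin n → Fin d) → Set
Proper Fs κ = ∀ u v → κ u ≢ κ v ⊎ u ≡ v ⊎ ¬ Span Fs (⁅ u ⁆ ∪ ⁅ v ⁆)

proper? : ∀ {d} (Fs : List (Subset n)) (κ : Fin n → Fin d) → Dec (Proper Fs κ)
proper? Fs κ = Fin.all? λ u → Fin.all? λ v →
  ¬? (κ u Fin.≟ κ v) ⊎-dec ((u Fin.≟ v) ⊎-dec ¬? (span? Fs (⁅ u ⁆ ∪ ⁅ v ⁆)))

colorable : ∀ (Δ : Complex n) {d Fs} {κ : Fin n → Fin d} → Generates Fs Δ → Proper Fs κ → Colorable d Δ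
colorable Δ {κ = κ} (Δ⇒Fs , _) proper = κ , λ u v u≢v uv∈Δ κu≡κv → case proper u v of λ where
  (inj₁ κu≢κv)      → κu≢κv κu≡κv
  (inj₂ (inj₁ u≡v)) → u≢v u≡v
  (inj₂ (inj₂ uv∉)) → uv∉ (Δ⇒Fs uv∈Δ)

LinksAcyclic : ℕ → List (Subset n) → List (Subset n) → Set
LinksAcyclic d Fs = All (λ F → acyclic? (d ℕ.∸ ∣ F ∣) (linkFacets F Fs) ≡ true)

linksAcyclic? : ∀ d (Fs σs : List (Subset n)) → Dec (LinksAcyclic d Fs σs)
linksAcyclic? d Fs = All.all? λ F → acyclic? (d ℕ.∸ ∣ F ∣) (linkFacets F Fs) Bool.≟ true

-- Generators of equal cardinality cannot contain one another properly, so each is maximal.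
isFacet⇔ : ∀ (Δ : Complex n) {d Fs} → Generates Fs Δ → Pure d Fs → ∀ {F} → IsFacet Δ F ⇔ F ∈ Fs
isFacet⇔ Δ {Fs = Fs} (Δ⇒Fs , Fs⇒Δ) pure {F} = mk⇔ to from
  where
  to : IsFacet Δ F → F ∈ Fs
  to (F∈Δ , maximal) with G , G∈Fs , F⊆G ← find (Δ⇒Fs F∈Δ) =
    subst (_∈ Fs) (≡.sym (maximal G (Fs⇒Δ (lose G∈Fs ⊆-refl)) F⊆G)) G∈Fs
  from : F ∈ Fs → IsFacet Δ F
  from F∈Fs = Fs⇒Δ (lose F∈Fs ⊆-refl) , λ τ τ∈Δ F⊆τ →
    let G , G∈Fs , τ⊆G = find (Δ⇒Fs τ∈Δ)
        G⊆F : G ⊆ F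
        G⊆F {x} x∈G = decidable-stable (x ∈? F) λ x∉F →
          ℕ.<⇒≢ (p⊂q⇒∣p∣<∣q∣ (⊆-trans F⊆τ τ⊆G , x , x∈G , x∉F))
                (≡.trans (All.lookup pure F∈Fs) (≡.sym (All.lookup pure G∈Fs)))
    in ⊆-antisym F⊆τ (⊆-trans τ⊆G G⊆F)

-- Pigeonhole over the glued copies.

module _ {N} (block : Fin 2 → Fin N → List (Subset n)) where

  -- `s` selects one of the two blocks in copy `i`. `edge` does not depend on `i`, being shared by
  -- all copies, whereas each copy has its own `apex`.
  BlocksForce : (Fin 2 → Subset n) → (Fin N → Subset n) → (Fin 2 → Fin N → List (Subset n)) →
                List (Subset n) → Set
  BlocksForce edge apex local Fs = ∀ s i → Forces Fs (block s i) (edge s ∷ apex i ∷ []) (local s i)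

  blocksForce? : ∀ edge apex local Fs → Dec (BlocksForce edge apex local Fs)
  blocksForce? edge apex local Fs = Fin.all? λ s → Fin.all? λ i →
    forces? Fs (block s i) (edge s ∷ apex i ∷ []) (local s i)

  BlocksDisjoint : Set
  BlocksDisjoint = ∀ s s′ i i′ → (s ≡ s′ × i ≡ i′) ⊎ All (λ F → All (F ≢_) (block s′ i′)) (block s i)

  blocksDisjoint? : Dec BlocksDisjoint
  blocksDisjoint? = Fin.all? λ s → Fin.all? λ s′ → Fin.all? λ i → Fin.all? λ i′ →
    ((s Fin.≟ s′) ×-dec (i Fin.≟ i′)) ⊎-dec
    All.all? (λ F → All.all? (λ F′ → ¬? (F ≟ F′)) (block s′ i′)) (block s i)

  ¬partitionable : ∀ (Δ : Complex n) {d Fs edge apex local} → 2 ℕ.< N →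
                   Generates Fs Δ → Pure d Fs → Unique Fs → WeightsBalance Fs →
                   BlocksForce edge apex local Fs → BlocksDisjoint → ¬ Partitionable Δ
  ¬partitionable Δ {Fs = Fs} {edge} {apex} 2<N Δ≗Fs@(_ , Fs⇒Δ) pure Fs! balance blocksForce blocksDisjoint
    (R , R⊆ , partition) =
    let i , j , i<j , same = Fin.pigeonhole 2<N (proj₁ ∘ side) in
    clash (λ (_ , i≡j) → Fin.<⇒≢ i<j i≡j) (proj₂ (side i))
      (subst (λ s → Covered (block s j) (edge s)) (≡.sym same) (proj₂ (side j)))
    where
    facet⇔ : ∀ {F} → IsFacet Δ F ⇔ F ∈ Fs
    facet⇔ = isFacet⇔ Δ Δ≗Fs pure
    open Equivalence using (to; from)

    cover : ∀ G → Span Fs G → ∃[ F ] F ∈ Fs × Covers G (F , R F)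
    cover G G∈Δ = let F , (isF , cF) , _ = partition G (Fs⇒Δ G∈Δ) in F , to facet⇔ isF , cF

    coverer-unique : ∀ {F F′ G} → F ∈ Fs → F′ ∈ Fs →
                     Covers G (F , R F) → Covers G (F′ , R F′) → F ≡ F′
    coverer-unique {G = G} F∈ F′∈ cF cF′ =
      let _ , _ , unique = partition G (Fs⇒Δ (lose F∈ (proj₂ cF)))
      in ≡.trans (≡.sym (unique (from facet⇔ F∈ , cF))) (unique (from facet⇔ F′∈ , cF′))

    open Partition Fs R (λ F∈ → R⊆ _ (from facet⇔ F∈)) cover coverer-unique

    edgeOrApex : ∀ s i → Any (Covered (block s i)) (edge s ∷ apex i ∷ [])
    edgeOrApex s i = forced (small Fs! balance) (blocksForce s i)

    clash : ∀ {s s′ i i′ T} → ¬ (s ≡ s′ × i ≡ i′) → Covered (block s i) T → ¬ Covered (block s′ i′) T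
    clash {s} {s′} {i} {i′} distinct T∈ T∈′ with blocksDisjoint s s′ i i′
    ... | inj₁ same     = distinct same
    ... | inj₂ disjoint =
      Covered-disjoint (Forces.Hs⊆Fs (blocksForce s i)) (Forces.Hs⊆Fs (blocksForce s′ i′)) disjoint T∈ T∈′

    side : ∀ i → ∃[ s ] Covered (block s i) (edge s)
    side i with edgeOrApex zero i | edgeOrApex (suc zero) i
    ... | here e             | _                  = zero , e
    ... | there (here apex₀) | here e             = suc zero , e
    ... | there (here apex₀) | there (here apex₁) = contradiction apex₁ (clash (λ ()) apex₀)

-- The complex C₃

facets : List (Subset 22)
facets = map face (concatMap (λ i → map (map (copy A*-vertices i)) Q*-facets) (allFin 3))

C₃-generated : Generates facets C₃
C₃-generated = ⟨⟩-generated (concatMap (λ i → map (map (copy A*-vertices i)) Q*-facets) (allFin 3))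

facets-pure : Pure 4 facets
facets-pure = toWitness {a? = pure? 4 facets} _

C₃-hasDim : HasDim C₃ (+ 4 ℤ.- 1ℤ)
C₃-hasDim = hasDim C₃ C₃-generated facets-pure

-- A colouring of Q* repeated in each copy: the first ten entries colour the vertices 0, 2, 3, 4, 6,
-- 7, 8, 10, 12, 13 of A*, and then 1, 5, 9, 11 receive the same four colours three times.
colour : Fin 22 → Fin 4
colour = Vec.lookup
  ( # 0 ∷ # 2 ∷ # 3 ∷ # 2 ∷ # 0 ∷ # 0 ∷ # 0 ∷ # 0 ∷ # 1 ∷ # 1
  ∷ # 1 ∷ # 3 ∷ # 3 ∷ # 2 ∷ # 1 ∷ # 3 ∷ # 3 ∷ # 2 ∷ # 1 ∷ # 3 ∷ # 3 ∷ # 2 ∷ [])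

C₃-balanced : Balanced C₃
C₃-balanced = 4 , C₃-hasDim , colorable C₃ C₃-generated (toWitness {a? = proper? facets colour} _)

C₃-linksAcyclic : LinksAcyclic 4 facets (faces facets)
C₃-linksAcyclic = toWitness {a? = linksAcyclic? 4 facets (faces facets)} _

C₃-cohenMacaulay : ∀ {c ℓ} (K : Field c ℓ) → CohenMacaulay K C₃
C₃-cohenMacaulay K = cohenMacaulay K C₃ 4 C₃-generated C₃-hasDim
  λ F F∈C₃ → All.lookup C₃-linksAcyclic (∈-faces⁺ (proj₁ C₃-generated F∈C₃))

C₃-hasFVector : HasFVector C₃ (1 ∷ 22 ∷ 101 ∷ 140 ∷ 60 ∷ [])
C₃-hasFVector = hasFVector C₃ C₃-generated C₃-hasDim
  (toWitness {a? = Vec.≡-dec ℕ._≟_ (f-vector 4 (faces facets)) (1 ∷ 22 ∷ 101 ∷ 140 ∷ 60 ∷ [])} _)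

-- The endpoints lie in A*, so every copy gives the same subset; copy `zero` is an arbitrary choice.
sharedEdge : Fin 2 → Subset 22
sharedEdge zero       = face (map (copy {N = 3} A*-vertices zero) (# 4 ∷ # 8 ∷ []))
sharedEdge (suc zero) = face (map (copy {N = 3} A*-vertices zero) (# 2 ∷ # 6 ∷ []))

apex : Fin 3 → Subset 22
apex i = face (map (copy A*-vertices i) (# 5 ∷ []))

-- Each face in `local` has a vertex among 1, 5, 9, private to its copy, so no facet of another copy
-- contains it. Suppose neither 4 8 nor 5 is covered. Then 4 8 9 puts 9 into the lower end of 1 4 8
-- 9, so 1 4 8 puts 1 into that of 1 4 5 8. The edges 4 5, 5 7, 5 13 now need distinct intervals
-- among 4 5 7 13, 4 5 8 13, 1 4 5 7, and two of these meet in 4 5 7 or 4 5 13. Replacing 4, 7, 8,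
-- 13 by 2, 0, 6, 12 gives the other block.
block local : Fin 2 → Fin 3 → List (Subset 22)
block zero       i = map (face ∘ map (copy A*-vertices i))
  ( (# 4 ∷ # 5 ∷ # 7 ∷ # 13 ∷ []) ∷ (# 4 ∷ # 5 ∷ # 8 ∷ # 13 ∷ []) ∷ (# 1 ∷ # 4 ∷ # 5 ∷ # 7 ∷ [])
  ∷ (# 1 ∷ # 4 ∷ # 5 ∷ # 8 ∷ []) ∷ (# 1 ∷ # 4 ∷ # 8 ∷ # 9 ∷ []) ∷ [])
block (suc zero) i = map (face ∘ map (copy A*-vertices i))
  ( (# 0 ∷ # 2 ∷ # 5 ∷ # 12 ∷ []) ∷ (# 2 ∷ # 5 ∷ # 6 ∷ # 12 ∷ []) ∷ (# 0 ∷ # 1 ∷ # 2 ∷ # 5 ∷ [])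
  ∷ (# 1 ∷ # 2 ∷ # 5 ∷ # 6 ∷ []) ∷ (# 1 ∷ # 2 ∷ # 6 ∷ # 9 ∷ []) ∷ [])
local zero       i = map (face ∘ map (copy A*-vertices i))
  ( (# 5 ∷ # 7 ∷ []) ∷ (# 4 ∷ # 5 ∷ []) ∷ (# 5 ∷ # 13 ∷ []) ∷ (# 4 ∷ # 8 ∷ # 9 ∷ [])
  ∷ (# 1 ∷ # 4 ∷ # 8 ∷ []) ∷ [])
local (suc zero) i = map (face ∘ map (copy A*-vertices i))
  ( (# 0 ∷ # 5 ∷ []) ∷ (# 2 ∷ # 5 ∷ []) ∷ (# 5 ∷ # 12 ∷ []) ∷ (# 2 ∷ # 6 ∷ # 9 ∷ [])
  ∷ (# 1 ∷ # 2 ∷ # 6 ∷ []) ∷ [])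

C₃-¬partitionable : ¬ Partitionable C₃
C₃-¬partitionable = ¬partitionable block C₃ {local = local} ℕ.≤-refl C₃-generated facets-pure
  (toWitness {a? = unique? facets} _)
  -- The total here is -3 + 2 · 22 - 101 + 60 = 0.
  (toWitness {a? = weightsBalance? facets} _)
  (toWitness {a? = blocksForce? block sharedEdge apex local facets} _)
  (toWitness {a? = blocksDisjoint? block} _)
  where open import Data.List.Relation.Unary.Unique.DecPropositional _≟_ using (unique?)

theorem3p8 : (c ℓ : Level) →
    Balanced C₃
    × ((K : Field c ℓ) → CohenMacaulay K C₃)
    × ¬ Partitionable C₃
    × HasFVector C₃ (1 ∷ 22 ∷ 101 ∷ 140 ∷ 60 ∷ [])
theorem3p8 c ℓ = C₃-balanced , C₃-cohenMacaulay , C₃-¬partitionable , C₃-hasFVector
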